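{- For every graph $G$, $\rho_e^o(G)=\alpha(A_G)$, where $A_G$ is the oriented star-conflict graph of $G$.
   Context: All graphs are finite, simple and undirected; $\alpha$ denotes the independence number. Two distinct edges $e_1,e_2\in E(G)$ have a common edge if there is an edge $e\in E(G)\setminus\{e_1,e_2\}$ joining an endpoint of $e_1$ to an endpoint of $e_2$. A set $D\subseteq E(G)$ is an edge open packing if no two edges of $D$ have a common edge. The edge open packing number $\rho_e^o(G)$ is the maximum cardinality of an edge open packing of $G$. The oriented star-conflict graph $A_G$ has vertex set $V(A_G)=\{(c,\ell): c\ell\in E(G)\}$, the set of ordered edges of $G$ (each edge gives two ordered edges). Two distinct ordered edges $(c,\ell)$ and $(d,r)$ are compatible if either (same centre) $c=d$, $\ell\ne r$ and $\ell r\notin E(G)$; or (different centres) $c\neq d$, the four vertices $c,\ell,d,r$ are distinct, and $cd,cr,\ell d,\ell r\notin E(G)$. Two distinct vertices of $A_G$ are adjacent if and only if the corresponding ordered edges are not compatible. -}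

module Defs where

open import Data.Empty using (⊥-elim-irr)
open import Data.Fin.Base using (zero; suc)
open import Data.Fin.Properties using (injective⇒≤)
open import Data.List.Base using (List; []; _∷_; length; lookup; concatMap; cartesianProduct; cartesianProductWith)
open import Data.List.Membership.Propositional using (_∈_; find; lose)
open import Data.List.Membership.Propositional.Properties using (∈-cartesianProduct⁺; ∈-cartesianProductWith⁺; ∈-concatMap⁺; ∈-lookup)
open import Data.List.Membership.Setoid.Properties using (index-injective)
open import Data.List.Relation.Binary.Pointwise using (Pointwise; []; _∷_; AllPairs-resp-Pointwise; Pointwise-length)
open import Data.List.Relation.Unary.All using ([]; _∷_)
import Data.List.Relation.Unary.All as All
open import Data.List.Relation.Unary.AllPairs using (AllPairs; []; _∷_; allPairs?)
open import Data.List.Relation.Unary.Any using (here; index; any?)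
import Data.List.Relation.Unary.Any as Any
open import Data.List.Relation.Unary.Enumerates.Setoid using (IsEnumeration)
import Data.List.Relation.Unary.Unique.Setoid as SetoidUnique
import Data.List.Relation.Unary.Unique.DecSetoid as DecSetoidUnique
open import Data.List.Relation.Unary.Unique.Propositional using (Unique)
import Data.List.Relation.Unary.Unique.DecPropositional as DecUnique
open import Data.Nat.Base using (ℕ; zero; suc; _≤_)
open import Data.Nat.Properties using (≤∧≢⇒<; ≤-pred)
import Data.Nat.Properties as ℕ
open import Data.Product.Base using (∃; ∃₂; _×_; _,_; proj₁; proj₂)
open import Data.Sum.Base using (_⊎_; inj₁; inj₂; [_,_]′)
open import Function.Base using (_∘_)
open import Level using (0ℓ)
open import Relation.Binary.Bundles using (Setoid; DecSetoid)
open import Relation.Binary.Core using (Rel)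
open import Relation.Binary.Definitions using (Decidable; DecidableEquality; Symmetric; Irreflexive; _Respects₂_)
open import Relation.Binary.PropositionalEquality using (_≡_; _≢_; refl; sym; cong; setoid; ≢-sym; decSetoid)
open import Relation.Nullary.Decidable using (Dec; yes; no; map′; _×-dec_; _⊎-dec_; ¬?)
open import Relation.Nullary.Negation using (¬_; contradiction)
open import Relation.Unary using (Pred)
import Relation.Unary as U

------------------------------------------------------------------------
-- Largest finite sets with a given property

-- A finite set of elements of S is a list without repetitions (up to _≈_),
-- and its cardinality is the length of that list.

module _ (S : Setoid 0ℓ 0ℓ) where

  private
    module S = Setoid S
    module SU = SetoidUnique S

  IsMaximumCardinality : Pred (List S.Carrier) 0ℓ → ℕ → Set
  IsMaximumCardinality P k =
    (∃ λ xs → SU.Unique xs × P xs × length xs ≡ k) ×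
    (∀ xs → SU.Unique xs → P xs → length xs ≤ k)

private

  boundedMaximum : {B : Pred ℕ 0ℓ} → U.Decidable B → B 0 →
                   ∀ n → (∀ {j} → B j → j ≤ n) →
                   ∃ λ k → B k × (∀ {j} → B j → j ≤ k)
  boundedMaximum B? b₀ zero bound = 0 , b₀ , bound
  boundedMaximum B? b₀ (suc n) bound with B? (suc n)
  ... | yes b = suc n , b , bound
  ... | no ¬b = boundedMaximum B? b₀ n λ {j} bj →
    ≤-pred (≤∧≢⇒< (bound bj) λ { refl → ¬b bj })

  listsOver : {A : Set} → List A → ℕ → List (List A)
  listsOver xs zero    = [] ∷ []
  listsOver xs (suc k) = cartesianProductWith _∷_ xs (listsOver xs k)

  ∃? : {A : Set} {xs : List A} → IsEnumeration (setoid A) xs →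
       {P : Pred A 0ℓ} → U.Decidable P → Dec (∃ P)
  ∃? {xs = xs} complete P? =
    map′ (λ p → proj₁ (find p) , proj₂ (proj₂ (find p)))
         (λ (x , px) → lose (complete x) px)
         (any? P? xs)

module _ (S : DecSetoid 0ℓ 0ℓ) where

  private
    module S = DecSetoid S
    module SU = DecSetoidUnique S

    lookup-unique : ∀ {xs} → SU.Unique xs → ∀ i j →
                    lookup xs i S.≈ lookup xs j → i ≡ j
    lookup-unique (x≉ ∷ u) zero    zero    e = refl
    lookup-unique (x≉ ∷ u) zero    (suc j) e = contradiction e (All.lookup x≉ (∈-lookup j))
    lookup-unique (x≉ ∷ u) (suc i) zero    e = contradiction (S.sym e) (All.lookup x≉ (∈-lookup i))
    lookup-unique (x≉ ∷ u) (suc i) (suc j) e = cong suc (lookup-unique u i j e)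

  maximumCardinality :
    ∀ {enum} → IsEnumeration S.setoid enum →
    {P : Pred (List S.Carrier) 0ℓ} → U.Decidable P →
    (∀ {xs ys} → Pointwise S._≈_ xs ys → P xs → P ys) →
    P [] → ∃ (IsMaximumCardinality S.setoid P)
  maximumCardinality {enum} complete {P} P? resp p₀ =
    let k , b , max = boundedMaximum B? ([] , [] , p₀ , refl) (length enum) bound
    in  k , b , λ xs u p → max (xs , u , p , refl)
    where
    B : Pred ℕ 0ℓ
    B k = ∃ λ xs → SU.Unique xs × P xs × length xs ≡ k

    bound : ∀ {j} → B j → j ≤ length enum
    bound (xs , u , _ , refl) =
      injective⇒≤ {f = λ i → index (complete (lookup xs i))} λ {i} {j} e →
        lookup-unique u i j (index-injective S.setoid (complete _) (complete _) e)

    represent : ∀ xs → ∃ λ ys → ys ∈ listsOver enum (length xs) × Pointwise S._≈_ xs ys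
    represent []       = [] , here refl , []
    represent (x ∷ xs) =
      let ys , ys∈ , xs≈ys = represent xs
          y , y∈ , x≈y     = find (complete x)
      in  y ∷ ys , ∈-cartesianProductWith⁺ _∷_ y∈ ys∈ , x≈y ∷ xs≈ys

    unique-resp : ∀ {xs ys} → Pointwise S._≈_ xs ys → SU.Unique xs → SU.Unique ys
    unique-resp = AllPairs-resp-Pointwise
      ( (λ y≈z x≉y x≈z → x≉y (S.trans x≈z (S.sym y≈z)))
      , (λ y≈z y≉x z≈x → y≉x (S.trans y≈z z≈x)))

    B? : U.Decidable B
    B? k = map′
      (λ p → let ys , _ , q = find p in ys , q)
      (λ { (xs , u , p , refl) →
           let ys , ys∈ , xs≈ys = represent xs
           in  lose ys∈ ( unique-resp xs≈ys u , resp xs≈ys p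
                        , sym (Pointwise-length xs≈ys)) })
      (any? (λ ys → SU.unique? ys ×-dec P? ys ×-dec (length ys ℕ.≟ k))
            (listsOver enum k))

------------------------------------------------------------------------
-- Finite simple undirected graphs

record Graph : Set₁ where
  infix 4 _~_ _~?_ _≟_
  field
    V        : Set
    _≟_      : DecidableEquality V
    vertices : List V
    complete : IsEnumeration (setoid V) vertices
    _~_      : Rel V 0ℓ
    _~?_     : Decidable _~_
    ~-sym    : Symmetric _~_
    ~-irrefl : Irreflexive _≡_ _~_

------------------------------------------------------------------------
-- Independence number

module _ (G : Graph) where
  open Graph G

  -- Adjacency is symmetric, so the order of the list is immaterial.

  IsIndependent : Pred (List V) 0ℓ
  IsIndependent = AllPairs (λ u v → ¬ u ~ v)

  IsIndependenceNumber : Pred ℕ 0ℓ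
  IsIndependenceNumber = IsMaximumCardinality (setoid V) IsIndependent

  hasIndependenceNumber : ∃ IsIndependenceNumber
  hasIndependenceNumber =
    maximumCardinality (decSetoid _≟_) complete
      (allPairs? λ u v → ¬? (u ~? v))
      (AllPairs-resp-Pointwise ((λ { refl r → r }) , (λ { refl r → r })))
      []

  α : ℕ
  α = proj₁ hasIndependenceNumber

------------------------------------------------------------------------
-- Ordered edges and edges

-- Irrelevance of the adjacency proof makes equality of ordered edges the
-- equality of their centres and leaves.

record OrderedEdge (G : Graph) : Set where
  constructor orderedEdge
  open Graph G
  field
    centre leaf : V
    .adjacent   : centre ~ leaf

module _ (G : Graph) where
  open Graph G
  open OrderedEdge

  _≟ₒ_ : DecidableEquality (OrderedEdge G)
  e ≟ₒ f = map′ (λ { (refl , refl) → refl }) (λ { refl → refl , refl })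
                (centre e ≟ centre f ×-dec leaf e ≟ leaf f)

  private
    orderedEdgesAt : V × V → List (OrderedEdge G)
    orderedEdgesAt (u , v) with u ~? v
    ... | yes u~v = orderedEdge u v u~v ∷ []
    ... | no  _   = []

    ∈-orderedEdgesAt : ∀ e → e ∈ orderedEdgesAt (centre e , leaf e)
    ∈-orderedEdgesAt (orderedEdge u v u~v) with u ~? v
    ... | yes _   = here refl
    ... | no  u≁v = ⊥-elim-irr (u≁v u~v)

  orderedEdges : List (OrderedEdge G)
  orderedEdges = concatMap orderedEdgesAt (cartesianProduct vertices vertices)

  orderedEdges-complete : IsEnumeration (setoid (OrderedEdge G)) orderedEdges
  orderedEdges-complete e =
    ∈-concatMap⁺ orderedEdgesAt
      (lose (∈-cartesianProduct⁺ (complete (centre e)) (complete (leaf e)))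
            (∈-orderedEdgesAt e))

  -- The edge e is the unordered pair {u, v}.

  Joins : OrderedEdge G → V → V → Set
  Joins e u v = (centre e ≡ u × leaf e ≡ v) ⊎ (centre e ≡ v × leaf e ≡ u)

  joins? : ∀ e u v → Dec (Joins e u v)
  joins? e u v = (centre e ≟ u ×-dec leaf e ≟ v) ⊎-dec (centre e ≟ v ×-dec leaf e ≟ u)

  -- E(G) is the setoid of ordered edges up to reversal.

  _≈ₑ_ : Rel (OrderedEdge G) 0ℓ
  e ≈ₑ f = Joins e (centre f) (leaf f)

  _≈ₑ?_ : Decidable _≈ₑ_
  e ≈ₑ? f = joins? e (centre f) (leaf f)

  private
    ≈ₑ-sym : Symmetric _≈ₑ_
    ≈ₑ-sym (inj₁ (refl , refl)) = inj₁ (refl , refl)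
    ≈ₑ-sym (inj₂ (refl , refl)) = inj₂ (refl , refl)

    ≈ₑ-trans : ∀ {e f g} → e ≈ₑ f → f ≈ₑ g → e ≈ₑ g
    ≈ₑ-trans (inj₁ (refl , refl)) q = q
    ≈ₑ-trans (inj₂ (refl , refl)) (inj₁ (refl , refl)) = inj₂ (refl , refl)
    ≈ₑ-trans (inj₂ (refl , refl)) (inj₂ (refl , refl)) = inj₁ (refl , refl)

  edgeDecSetoid : DecSetoid 0ℓ 0ℓ
  edgeDecSetoid = record
    { Carrier = OrderedEdge G
    ; _≈_     = _≈ₑ_
    ; isDecEquivalence = record
      { isEquivalence = record
        { refl  = inj₁ (refl , refl)
        ; sym   = λ {e} {f} → ≈ₑ-sym {e} {f}
        ; trans = λ {e} {f} {g} → ≈ₑ-trans {e} {f} {g}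
        }
      ; _≟_ = _≈ₑ?_
      }
    }

  edgeSetoid : Setoid 0ℓ 0ℓ
  edgeSetoid = DecSetoid.setoid edgeDecSetoid

------------------------------------------------------------------------
-- Edge open packing number

  _IsEndpointOf_ : V → OrderedEdge G → Set
  v IsEndpointOf e = v ≡ centre e ⊎ v ≡ leaf e

  HaveCommonEdge : Rel (OrderedEdge G) 0ℓ
  HaveCommonEdge e₁ e₂ =
    ∃ λ e → ¬ e ≈ₑ e₁ × ¬ e ≈ₑ e₂ ×
    ∃₂ λ u v → u IsEndpointOf e₁ × v IsEndpointOf e₂ × Joins e u v

  private
    endpoint? : ∀ v e → Dec (v IsEndpointOf e)
    endpoint? v e = v ≟ centre e ⊎-dec v ≟ leaf e

    haveCommonEdge? : Decidable HaveCommonEdge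
    haveCommonEdge? e₁ e₂ =
      ∃? orderedEdges-complete λ e → ¬? (e ≈ₑ? e₁) ×-dec ¬? (e ≈ₑ? e₂) ×-dec
      ∃? complete λ u → ∃? complete λ v →
        endpoint? u e₁ ×-dec endpoint? v e₂ ×-dec joins? e u v

    endpoint-resp : ∀ {v e f} → e ≈ₑ f → v IsEndpointOf e → v IsEndpointOf f
    endpoint-resp (inj₁ (refl , refl)) p        = p
    endpoint-resp (inj₂ (refl , refl)) (inj₁ p) = inj₂ p
    endpoint-resp (inj₂ (refl , refl)) (inj₂ p) = inj₁ p

    ¬haveCommonEdge-resp : (λ e f → ¬ HaveCommonEdge e f) Respects₂ _≈ₑ_
    ¬haveCommonEdge-resp =
      (λ {x} {y} {z} y≈z n (e , e≉x , e≉z , u , v , p , q , r) →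
        n (e , e≉x , (λ e≈y → e≉z (≈ₑ-trans {e} {y} {z} e≈y y≈z)) , u , v
          , p , endpoint-resp {v} {z} {y} (≈ₑ-sym {y} {z} y≈z) q , r)) ,
      (λ {x} {y} {z} y≈z n (e , e≉z , e≉x , u , v , p , q , r) →
        n (e , (λ e≈y → e≉z (≈ₑ-trans {e} {y} {z} e≈y y≈z)) , e≉x , u , v
          , endpoint-resp {u} {z} {y} (≈ₑ-sym {y} {z} y≈z) p , q , r))

  -- HaveCommonEdge is symmetric, so the order of the list is immaterial;
  -- distinct positions hold distinct edges because maxima range over
  -- repetition-free lists.

  IsEdgeOpenPacking : Pred (List (OrderedEdge G)) 0ℓ
  IsEdgeOpenPacking = AllPairs (λ e f → ¬ HaveCommonEdge e f)

  IsEdgeOpenPackingNumber : Pred ℕ 0ℓ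
  IsEdgeOpenPackingNumber = IsMaximumCardinality edgeSetoid IsEdgeOpenPacking

  hasEdgeOpenPackingNumber : ∃ IsEdgeOpenPackingNumber
  hasEdgeOpenPackingNumber =
    maximumCardinality edgeDecSetoid
      (λ e → Any.map (λ { refl → inj₁ (refl , refl) }) (orderedEdges-complete e))
      (allPairs? λ e f → ¬? (haveCommonEdge? e f))
      (AllPairs-resp-Pointwise ¬haveCommonEdge-resp)
      []

  ρₑᵒ : ℕ
  ρₑᵒ = proj₁ hasEdgeOpenPackingNumber

------------------------------------------------------------------------
-- Oriented star-conflict graph

  data Compatible : Rel (OrderedEdge G) 0ℓ where
    sameCentre : ∀ {e f} → centre e ≡ centre f → leaf e ≢ leaf f →
                 ¬ leaf e ~ leaf f → Compatible e f
    differentCentres : ∀ {e f} → centre e ≢ centre f →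
                 Unique (centre e ∷ leaf e ∷ centre f ∷ leaf f ∷ []) →
                 ¬ centre e ~ centre f → ¬ centre e ~ leaf f →
                 ¬ leaf e ~ centre f → ¬ leaf e ~ leaf f → Compatible e f

  compatible? : Decidable Compatible
  compatible? e f = map′
    [ (λ (p , q , r) → sameCentre p q r)
    , (λ (p , u , a , b , c , d) → differentCentres p u a b c d) ]′
    (λ { (sameCentre p q r) → inj₁ (p , q , r)
       ; (differentCentres p u a b c d) → inj₂ (p , u , a , b , c , d) })
    ((centre e ≟ centre f ×-dec ¬? (leaf e ≟ leaf f) ×-dec ¬? (leaf e ~? leaf f))
     ⊎-dec
     (¬? (centre e ≟ centre f) ×-dec
      DecUnique.unique? _≟_ (centre e ∷ leaf e ∷ centre f ∷ leaf f ∷ []) ×-dec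
      ¬? (centre e ~? centre f) ×-dec ¬? (centre e ~? leaf f) ×-dec
      ¬? (leaf e ~? centre f) ×-dec ¬? (leaf e ~? leaf f)))

  Compatible-sym : Symmetric Compatible
  Compatible-sym (sameCentre p q r) = sameCentre (sym p) (≢-sym q) (r ∘ ~-sym)
  Compatible-sym (differentCentres p
      ((cl ∷ cd ∷ cr ∷ []) ∷ (ld ∷ lr ∷ []) ∷ (dr ∷ []) ∷ [] ∷ []) a b c d) =
    differentCentres (≢-sym p)
      ((dr ∷ ≢-sym cd ∷ ≢-sym ld ∷ []) ∷ (≢-sym cr ∷ ≢-sym lr ∷ []) ∷ (cl ∷ []) ∷ [] ∷ [])
      (a ∘ ~-sym) (c ∘ ~-sym) (b ∘ ~-sym) (d ∘ ~-sym)

  starConflictGraph : Graph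
  starConflictGraph = record
    { V        = OrderedEdge G
    ; _≟_      = _≟ₒ_
    ; vertices = orderedEdges
    ; complete = orderedEdges-complete
    ; _~_      = λ e f → e ≢ f × ¬ Compatible e f
    ; _~?_     = λ e f → ¬? (e ≟ₒ f) ×-dec ¬? (compatible? e f)
    ; ~-sym    = λ (e≢f , n) → ≢-sym e≢f , n ∘ Compatible-sym
    ; ~-irrefl = λ e≡f (e≢f , _) → e≢f e≡f
    }

-- In an edge open packing D no edge e = vw meets other members of D at both v
-- and w, for e would be a common edge of those members.  Hence e can be
-- oriented with its shared endpoint, if any, as centre, and then any two
-- members are compatible.  Conversely, compatible ordered edges have no common
-- edge.

module Submission where

open import Defs
open import Data.Empty using (⊥-elim-irr)
open import Data.List.Base using (List; []; _∷_; length; map)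
open import Data.List.Membership.Propositional using (_∈_; find; lose)
open import Data.List.Properties using (length-map)
open import Data.List.Relation.Unary.All using ([]; _∷_)
import Data.List.Relation.Unary.All as All
open import Data.List.Relation.Unary.AllPairs using (AllPairs; []; _∷_)
import Data.List.Relation.Unary.AllPairs as AllPairs
import Data.List.Relation.Unary.AllPairs.Properties as AllPairs
open import Data.List.Relation.Unary.Any using (Any; here; there; any?)
open import Data.Nat.Base using (_≤_)
open import Data.Nat.Properties using (≤-antisym; module ≤-Reasoning)
open import Data.Product.Base using (_×_; _,_; proj₁; proj₂)
open import Data.Sum.Base using (inj₁; inj₂)
open import Function.Base using (_∘_)
open import Level using (0ℓ)
open import Relation.Binary.Bundles using (DecSetoid)
open import Relation.Binary.Core using (Rel)
open import Relation.Binary.Definitions using (Symmetric)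
open import Relation.Binary.PropositionalEquality using (_≡_; _≢_; refl; sym; trans)
open import Relation.Nullary.Decidable using (Dec; yes; no; _×-dec_; _⊎-dec_; ¬?; decidable-stable)
open import Relation.Nullary.Negation using (¬_; contradiction)

module _ {A : Set} {R : Rel A 0ℓ} where

  -- Symmetry is what allows `x` and `y` to come in either order in the list; `x ≢ y` rules out a
  -- shared position.
  AllPairs-lookup : Symmetric R → ∀ {xs} → AllPairs R xs →
                    ∀ {x y} → x ∈ xs → y ∈ xs → x ≢ y → R x y
  AllPairs-lookup R-sym (r ∷ rs) (here refl) (here refl) x≢y = contradiction refl x≢y
  AllPairs-lookup R-sym (r ∷ rs) (here refl) (there y∈)  x≢y = All.lookup r y∈
  AllPairs-lookup R-sym (r ∷ rs) (there x∈)  (here refl) x≢y = R-sym (All.lookup r x∈)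
  AllPairs-lookup R-sym (r ∷ rs) (there x∈)  (there y∈)  x≢y = AllPairs-lookup R-sym rs x∈ y∈ x≢y

  -- The implication may use membership: how an edge is oriented depends on the whole packing, so
  -- compatibility can be shown only for members of it.
  AllPairs-map∈ : {S : Rel A 0ℓ} → ∀ {xs} →
                  (∀ {x y} → x ∈ xs → y ∈ xs → R x y → S x y) →
                  AllPairs R xs → AllPairs S xs
  AllPairs-map∈ imp []       = []
  AllPairs-map∈ imp (r ∷ rs) =
    All.tabulate (λ y∈ → imp (here refl) (there y∈) (All.lookup r y∈)) ∷
    AllPairs-map∈ (λ x∈ y∈ → imp (there x∈) (there y∈)) rs

module _ (G : Graph) where
  open Graph G
  open OrderedEdge
  open DecSetoid (edgeDecSetoid G) using (_≈_; _≉_) renaming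
    (refl to ≈-refl; sym to ≈-sym; trans to ≈-trans; _≟_ to _≈?_)

  private
    E : Set
    E = OrderedEdge G

    infix 4 _∈ₑ_ _∈ₑ?_
    _∈ₑ_ : V → E → Set
    _∈ₑ_ = _IsEndpointOf_ G

    _∈ₑ?_ : ∀ v e → Dec (v ∈ₑ e)
    v ∈ₑ? e = v ≟ centre e ⊎-dec v ≟ leaf e

  centre≢leaf : (e : E) → centre e ≢ leaf e
  centre≢leaf (orderedEdge c l c~l) c≡l = ⊥-elim-irr (~-irrefl c≡l c~l)

  ∈ₑ-resp-≈ : ∀ e f {v} → e ≈ f → v ∈ₑ e → v ∈ₑ f
  ∈ₑ-resp-≈ e f (inj₁ (refl , refl)) v∈e         = v∈e
  ∈ₑ-resp-≈ e f (inj₂ (refl , refl)) (inj₁ refl) = inj₂ refl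
  ∈ₑ-resp-≈ e f (inj₂ (refl , refl)) (inj₂ refl) = inj₁ refl

  endpoints⇒≈ : ∀ e f → centre e ∈ₑ f → leaf e ∈ₑ f → e ≈ f
  endpoints⇒≈ e f (inj₁ p) (inj₁ q) = contradiction (trans p (sym q)) (centre≢leaf e)
  endpoints⇒≈ e f (inj₁ p) (inj₂ q) = inj₁ (p , q)
  endpoints⇒≈ e f (inj₂ p) (inj₁ q) = inj₂ (p , q)
  endpoints⇒≈ e f (inj₂ p) (inj₂ q) = contradiction (trans p (sym q)) (centre≢leaf e)

  HaveCommonEdge-sym : ∀ e f → HaveCommonEdge G e f → HaveCommonEdge G f e
  HaveCommonEdge-sym e f (g , g≉e , g≉f , u , v , u∈e , v∈f , g=uv) =
    g , g≉f , g≉e , v , u , v∈f , u∈e , Joins-swap g=uv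
    where
    Joins-swap : Joins G g u v → Joins G g v u
    Joins-swap (inj₁ p) = inj₂ p
    Joins-swap (inj₂ p) = inj₁ p

  HaveCommonEdge-respˡ : ∀ e e′ f → e ≈ e′ → HaveCommonEdge G e f → HaveCommonEdge G e′ f
  HaveCommonEdge-respˡ e e′ f e≈e′ (g , g≉e , g≉f , u , v , u∈e , v∈f , g=uv) =
    g , (λ g≈e′ → g≉e (≈-trans {g} {e′} {e} g≈e′ (≈-sym {e} {e′} e≈e′))) , g≉f ,
    u , v , ∈ₑ-resp-≈ e e′ e≈e′ u∈e , v∈f , g=uv

  HaveCommonEdge-resp : ∀ e e′ f f′ → e ≈ e′ → f ≈ f′ →
                        HaveCommonEdge G e f → HaveCommonEdge G e′ f′
  HaveCommonEdge-resp e e′ f f′ e≈e′ f≈f′ =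
    HaveCommonEdge-sym f′ e′ ∘ HaveCommonEdge-respˡ f f′ e′ f≈f′ ∘
    HaveCommonEdge-sym e′ f ∘ HaveCommonEdge-respˡ e e′ f e≈e′

  -- The common edge is `uv` itself: it differs from `e` because `v` is off `e`, and from `f`
  -- because `u` is off `f`.
  ~⇒HaveCommonEdge : ∀ e f {u v} → u ∈ₑ e → v ∈ₑ f → ¬ v ∈ₑ e → ¬ u ∈ₑ f →
                     u ~ v → HaveCommonEdge G e f
  ~⇒HaveCommonEdge e f {u} {v} u∈e v∈f v∉e u∉f u~v =
    uv , (λ uv≈e → v∉e (∈ₑ-resp-≈ uv e uv≈e (inj₂ refl)))
       , (λ uv≈f → u∉f (∈ₑ-resp-≈ uv f uv≈f (inj₁ refl)))
       , u , v , u∈e , v∈f , inj₁ (refl , refl)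
    where
    uv : E
    uv = orderedEdge u v u~v

  -- Ensures that an independent set never contains both orientations of one edge, so that it has as
  -- many edges as ordered edges.
  Compatible⇒≉ : ∀ e f → Compatible G e f → e ≉ f
  Compatible⇒≉ e f (sameCentre c≡d l≢r _) (inj₁ (_ , l≡r)) = l≢r l≡r
  Compatible⇒≉ e f (sameCentre c≡d l≢r _) (inj₂ (c≡r , _)) =
    centre≢leaf f (trans (sym c≡d) c≡r)
  Compatible⇒≉ e f (differentCentres c≢d _ _ _ _ _) (inj₁ (c≡d , _)) = c≢d c≡d
  Compatible⇒≉ e f (differentCentres _ ((_ ∷ _ ∷ c≢r ∷ []) ∷ _) _ _ _ _) (inj₂ (c≡r , _)) =
    c≢r c≡r

  -- With equal centres, an edge from the centre to a leaf is `e` or `f` itself, which `g` is not;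
  -- every other pair is nonadjacent by compatibility or irreflexivity. Concluding with a negation
  -- lets the irrelevant adjacency proof of `g` be supplied by the caller.
  Compatible⇒nonadjacent : ∀ e f g {u v} → Compatible G e f → u ∈ₑ e → v ∈ₑ f →
                           centre g ≡ u → leaf g ≡ v → g ≉ e → g ≉ f → ¬ u ~ v
  Compatible⇒nonadjacent e f g (sameCentre c≡d _ _) (inj₁ refl) (inj₁ refl) _ _ _ _ =
    ~-irrefl c≡d
  Compatible⇒nonadjacent e f g (sameCentre c≡d _ _) (inj₁ refl) (inj₂ refl) p q _ g≉f _ =
    g≉f (inj₁ (trans p c≡d , q))
  Compatible⇒nonadjacent e f g (sameCentre c≡d _ _) (inj₂ refl) (inj₁ refl) p q g≉e _ _ =
    g≉e (inj₂ (p , trans q (sym c≡d)))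
  Compatible⇒nonadjacent e f g (sameCentre _ _ l≁r) (inj₂ refl) (inj₂ refl) _ _ _ _ = l≁r
  Compatible⇒nonadjacent e f g (differentCentres _ _ c≁d _ _ _) (inj₁ refl) (inj₁ refl) _ _ _ _ = c≁d
  Compatible⇒nonadjacent e f g (differentCentres _ _ _ c≁r _ _) (inj₁ refl) (inj₂ refl) _ _ _ _ = c≁r
  Compatible⇒nonadjacent e f g (differentCentres _ _ _ _ l≁d _) (inj₂ refl) (inj₁ refl) _ _ _ _ = l≁d
  Compatible⇒nonadjacent e f g (differentCentres _ _ _ _ _ l≁r) (inj₂ refl) (inj₂ refl) _ _ _ _ = l≁r

  Compatible⇒¬HaveCommonEdge : ∀ e f → Compatible G e f → ¬ HaveCommonEdge G e f
  Compatible⇒¬HaveCommonEdge e f e∥f (g@(orderedEdge _ _ c~l) , g≉e , g≉f , _ , _ , u∈e , v∈f , inj₁ (refl , refl)) =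
    ⊥-elim-irr (Compatible⇒nonadjacent e f g e∥f u∈e v∈f refl refl g≉e g≉f c~l)
  -- Here `g` runs from `f` to `e`, so the two edges exchange roles.
  Compatible⇒¬HaveCommonEdge e f e∥f (g@(orderedEdge _ _ c~l) , g≉e , g≉f , _ , _ , u∈e , v∈f , inj₂ (refl , refl)) =
    ⊥-elim-irr (Compatible⇒nonadjacent f e g (Compatible-sym G e∥f) v∈f u∈e refl refl g≉f g≉e c~l)

  -- If the centres differ, no vertex can be the centre of both, so the edges are disjoint and any
  -- adjacency between them would be a common edge. If the centres agree, only adjacent leaves could
  -- violate compatibility, and these too would give a common edge.
  centred⇒Compatible : ∀ e f → e ≉ f → ¬ HaveCommonEdge G e f →
                       (∀ {v} → v ∈ₑ e → v ∈ₑ f → centre e ≡ v × centre f ≡ v) →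
                       Compatible G e f
  centred⇒Compatible e f e≉f nc centred with centre e ≟ centre f
  ... | yes c≡d = sameCentre c≡d (λ l≡r → e≉f (inj₁ (c≡d , l≡r)))
    (nc ∘ ~⇒HaveCommonEdge e f (inj₂ refl) (inj₂ refl)
      -- A leaf lying on the other edge would be a shared vertex, hence the centre of its own edge.
      (λ r∈e → centre≢leaf f (proj₂ (centred r∈e (inj₂ refl))))
      (λ l∈f → centre≢leaf e (proj₁ (centred (inj₂ refl) l∈f))))
  ... | no c≢d = differentCentres c≢d
    ((centre≢leaf e ∷ c≢d ∷ distinct (inj₁ refl) (inj₂ refl) ∷ []) ∷
     (distinct (inj₂ refl) (inj₁ refl) ∷ distinct (inj₂ refl) (inj₂ refl) ∷ []) ∷
     (centre≢leaf f ∷ []) ∷ [] ∷ [])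
    (nonadjacent (inj₁ refl) (inj₁ refl)) (nonadjacent (inj₁ refl) (inj₂ refl))
    (nonadjacent (inj₂ refl) (inj₁ refl)) (nonadjacent (inj₂ refl) (inj₂ refl))
    where
    disjoint : ∀ {v} → v ∈ₑ e → ¬ v ∈ₑ f
    disjoint v∈e v∈f = let p , q = centred v∈e v∈f in c≢d (trans p (sym q))

    distinct : ∀ {u v} → u ∈ₑ e → v ∈ₑ f → u ≢ v
    distinct u∈e v∈f refl = disjoint u∈e v∈f

    nonadjacent : ∀ {u v} → u ∈ₑ e → v ∈ₑ f → ¬ u ~ v
    nonadjacent u∈e v∈f =
      nc ∘ ~⇒HaveCommonEdge e f u∈e v∈f (λ v∈e → disjoint v∈e v∈f) (disjoint u∈e)

  reverse : E → E
  reverse (orderedEdge c l c~l) = orderedEdge l c (~-sym c~l)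

  LeafShared : List E → E → Set
  LeafShared D e = Any (λ f → e ≉ f × leaf e ∈ₑ f) D

  leafShared? : ∀ D e → Dec (LeafShared D e)
  leafShared? D e = any? (λ f → ¬? (e ≈? f) ×-dec leaf e ∈ₑ? f) D

  -- At most one endpoint of a member of a packing is shared with other members, so reversing
  -- exactly when the leaf is shared puts the shared endpoint at the centre.
  orient : List E → E → E
  orient D e with leafShared? D e
  ... | yes _ = reverse e
  ... | no  _ = e

  orient≈ : ∀ D e → orient D e ≈ e
  orient≈ D e with leafShared? D e
  ... | yes _ = inj₂ (refl , refl)
  ... | no  _ = inj₁ (refl , refl)

  centre-orient : ∀ {D} → IsEdgeOpenPacking G D → ∀ {e f v} → e ∈ D → f ∈ D → e ≉ f →
                  v ∈ₑ e → v ∈ₑ f → centre (orient D e) ≡ v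
  centre-orient {D} D-packing {e} {f} e∈D f∈D e≉f v∈e v∈f with leafShared? D e | v∈e
  ... | yes _ | inj₂ refl = refl
  ... | no ¬s | inj₂ refl = contradiction (lose f∈D (e≉f , v∈f)) ¬s
  ... | no _  | inj₁ refl = refl
  -- Both endpoints are shared: the centre with `f`, the leaf with some `g`. Then `e` is a common
  -- edge of `f` and `g`.
  ... | yes s | inj₁ refl with find s
  ...   | g , g∈D , e≉g , l∈g = contradiction
    (e , e≉f , e≉g , centre e , leaf e , v∈f , l∈g , inj₁ (refl , refl))
    (AllPairs-lookup (λ {x} {y} → _∘ HaveCommonEdge-sym y x) D-packing f∈D g∈D
      -- If `g` were `f`, both endpoints of `e` would lie on `f`, forcing `e ≈ f`.
      λ { refl → e≉f (endpoints⇒≈ e f v∈f l∈g) })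

  -- Distinctness and the absence of a common edge survive reorientation; `centre-orient`, applied
  -- to each edge in turn, makes every shared vertex the centre of both.
  orient-Compatible : ∀ {D} → IsEdgeOpenPacking G D → ∀ {e f} → e ∈ D → f ∈ D →
                      e ≉ f × ¬ HaveCommonEdge G e f →
                      Compatible G (orient D e) (orient D f)
  orient-Compatible {D} D-packing {e} {f} e∈D f∈D (e≉f , nc) =
    centred⇒Compatible e′ f′
      (λ e′≈f′ → e≉f (≈-trans {e} {e′} {f} (≈-sym {e′} {e} e′≈e)
                                          (≈-trans {e′} {f′} {f} e′≈f′ f′≈f)))
      (nc ∘ HaveCommonEdge-resp e′ e f′ f e′≈e f′≈f)
      λ v∈e′ v∈f′ →
        let v∈e = ∈ₑ-resp-≈ e′ e e′≈e v∈e′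
            v∈f = ∈ₑ-resp-≈ f′ f f′≈f v∈f′
        in centre-orient D-packing e∈D f∈D e≉f v∈e v∈f ,
           centre-orient D-packing f∈D e∈D (e≉f ∘ ≈-sym {f} {e}) v∈f v∈e
    where
    e′ f′ : E
    e′ = orient D e
    f′ = orient D f

    e′≈e : e′ ≈ e
    e′≈e = orient≈ D e

    f′≈f : f′ ≈ f
    f′≈f = orient≈ D f

  ρₑᵒ≤α : ρₑᵒ G ≤ α (starConflictGraph G)
  ρₑᵒ≤α =
    let (D , D-unique , D-packing , |D|≡ρ) , _ = proj₂ (hasEdgeOpenPackingNumber G)
        _ , α-max = proj₂ (hasIndependenceNumber (starConflictGraph G))
        compatible : AllPairs (Compatible G) (map (orient D) D)
        compatible = AllPairs.map⁺ (AllPairs-map∈ (orient-Compatible D-packing)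
                                                   (AllPairs.zip (D-unique , D-packing)))
    in begin
      ρₑᵒ G                      ≡⟨ |D|≡ρ ⟨
      length D                   ≡⟨ length-map (orient D) D ⟨
      length (map (orient D) D)  ≤⟨ α-max _
        -- No ordered edge is compatible with itself, so the oriented list has no repetitions.
        (AllPairs.map (λ { {e} e∥f refl → Compatible⇒≉ e e e∥f (≈-refl {e}) }) compatible)
        (AllPairs.map (λ e∥f (_ , e∦f) → e∦f e∥f) compatible) ⟩
      α (starConflictGraph G)    ∎
    where open ≤-Reasoning

  α≤ρₑᵒ : α (starConflictGraph G) ≤ ρₑᵒ G
  α≤ρₑᵒ =
    let (I , I-unique , I-independent , |I|≡α) , _ =
          proj₂ (hasIndependenceNumber (starConflictGraph G))
        _ , ρ-max = proj₂ (hasEdgeOpenPackingNumber G)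
        compatible : AllPairs (Compatible G) I
        compatible = AllPairs.zipWith
          -- Nonadjacency of distinct vertices gives only the double negation of compatibility,
          -- which decidability removes.
          (λ {e} {f} (e≢f , e≁f) → decidable-stable (compatible? G e f) (λ e∦f → e≁f (e≢f , e∦f)))
          (I-unique , I-independent)
    in begin
      α (starConflictGraph G)  ≡⟨ |I|≡α ⟨
      length I                 ≤⟨ ρ-max I (AllPairs.map (λ {e} {f} → Compatible⇒≉ e f) compatible)
        (AllPairs.map (λ {e} {f} → Compatible⇒¬HaveCommonEdge e f) compatible) ⟩
      ρₑᵒ G                    ∎
    where open ≤-Reasoning

lemma2 : (G : Graph) → ρₑᵒ G ≡ α (starConflictGraph G)
lemma2 G = ≤-antisym (ρₑᵒ≤α G) (α≤ρₑᵒ G)
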